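{- For every permutation $\pi$ of $\{1,\dots,n\}$, the Rosenstiehl–Tarjan–Modified algorithm run on $\pi$ returns TRUE if and only if $\pi$ can be sorted on a deque.
   Context: Sorting on a deque: a state consists of the output, the deque and the input. Initially the output and deque are empty and the input is $\pi$. Allowed operations: move the first input element to the left end or to the right end of the deque; move the left end or the right end element of a nonempty deque to the end of the output. $\pi$ is sortable on a deque if some sequence of these operations ends with output $1,2,\dots,n$. Twinstacks: a twinstack $[L,R]$ is a pair of stacks (left stack $L$, right stack $R$), not both empty, each containing elements strictly increasing from top to bottom. Reversing a twinstack swaps $L$ and $R$. A pile is a stack of twinstacks; welding the top twinstack $[L_1,R_1]$ onto the second twinstack $[L_2,R_2]$ replaces both by the single twinstack whose left stack is $L_1$ placed on top of $L_2$ and whose right stack is $R_1$ placed on top of $R_2$. The Rosenstiehl–Tarjan–Modified algorithm maintains an output list $O$ (initially empty), a pile $P$ (initially empty) and an input list $I$ (initially $\pi$). While $I$ is nonempty it performs three steps; when $I$ becomes empty it returns TRUE. (1) FromInput: remove the first element $x$ of $I$ and push the twinstack $[(x),()]$ on top of $P$. (2) Normalize: let $T$ be the top twinstack and $T_2$ the second one. If there is no $T_2$, the step succeeds. Otherwise let $x$ be the top element of the left stack of $T$, and: (i) if the right stack of $T_2$ is nonempty and $x$ is smaller than both top elements of $T_2$, succeed; (ii) if the right stack of $T_2$ is nonempty and $x$ lies between the two top elements of $T_2$, reverse $T$ if necessary so that $x$ lies over the side of $T_2$ whose top element is larger than $x$, weld $T$ onto $T_2$, and succeed; (iii) if the right stack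 of $T_2$ is nonempty and $x$ is larger than both its top elements, the algorithm returns FALSE; (iv) if the right stack of $T_2$ is empty and $x$ is smaller than the top of the left stack of $T_2$, succeed; (v) if the right stack of $T_2$ is empty and $x$ is larger than the top of the left stack of $T_2$: if $T_2$ is the bottom twinstack of the pile and $x$ is larger than every element of $T_2$, remove $x$ from $T$, place it at the bottom of the left stack of $T_2$, then (if $T$ is still nonempty) reverse $T$ and weld it onto $T_2$ (removing $T$ if it became empty), and succeed; otherwise reverse $T_2$, weld $T$ onto $T_2$, and repeat the Normalize step. (3) ToOutput: repeatedly, let $T$ be the top twinstack and $c$ the next element required by the output ($c=1+{}$the number of elements in $O$). If the top of the right stack of $T$ equals $c$, move it to the end of $O$; otherwise, if the top of the left stack of $T$ equals $c$, move it to the end of $O$; otherwise stop this step. After such a move, remove $T$ if it is empty, and otherwise reverse $T$ if necessary so that the larger of its two top elements is on its left stack; moreover, if the element was popped from the right stack of the bottom twinstack of the pile and, after the pop, that twinstack is monotonic (one of its stacks is empty, or one of its stacks consists of a single element larger than every element of the other stack), rearrange it to be one-sided by moving that single largest element to the bottom of the stack containing the other elements. -}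

module Defs where

open import Data.Nat using (ℕ; zero; suc; _<ᵇ_; _≡ᵇ_)
open import Data.Bool using (Bool; true; false; if_then_else_; _∧_; not)
open import Data.List using (List; []; _∷_; _++_; [_]; length; applyUpTo)
open import Data.Maybe using (Maybe; just; nothing)
open import Data.Product using (_×_; _,_; ∃)
open import Relation.Binary.PropositionalEquality using (_≡_)
open import Relation.Binary.Construct.Closure.ReflexiveTransitive using (Star)

[1‥_] : ℕ → List ℕ
[1‥ n ] = applyUpTo suc n

-- Sorting on a deque
-- A state is (output , deque , input).  The output is listed in order
-- (its end is the end of the list); the deque is listed from its left
-- end to its right end; the input is listed from its first element.

DState : Set
DState = List ℕ × List ℕ × List ℕ

data DStep : DState → DState → Set where
  inLeft   : ∀ {o d x i} → DStep (o , d , x ∷ i) (o , x ∷ d , i)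
  inRight  : ∀ {o d x i} → DStep (o , d , x ∷ i) (o , d ++ [ x ] , i)
  outLeft  : ∀ {o d x i} → DStep (o , x ∷ d , i) (o ++ [ x ] , d , i)
  outRight : ∀ {o d x i} → DStep (o , d ++ [ x ] , i) (o ++ [ x ] , d , i)

DequeSortable : List ℕ → Set
DequeSortable π =
  ∃ λ (d : List ℕ) → ∃ λ (i : List ℕ) →
    Star DStep ([] , [] , π) ([1‥ length π ] , d , i)

-- Twinstacks and piles
-- A twinstack is a pair (L , R) of stacks, each listed top first.
-- A pile is a list of twinstacks, top twinstack first.

Twin : Set
Twin = List ℕ × List ℕ

Pile : Set
Pile = List Twin

reverseT : Twin → Twin
reverseT (l , r) = (r , l)

weld : Twin → Twin → Twin
weld (l₁ , r₁) (l₂ , r₂) = (l₁ ++ l₂ , r₁ ++ r₂)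

isEmptyT : Twin → Bool
isEmptyT ([] , []) = true
isEmptyT _         = false

allLt : ℕ → List ℕ → Bool
allLt x []      = true
allLt x (e ∷ l) = (e <ᵇ x) ∧ allLt x l

-- top of a stack; an empty stack is given the value 0, which is
-- smaller than every element (elements are ≥ 1)
top : List ℕ → ℕ
top []      = 0
top (x ∷ _) = x

-- Normalize.  norm T P : T is the top twinstack, P the pile below it.
-- nothing = the algorithm returns FALSE.

norm : Twin → Pile → Maybe Pile
norm T [] = just (T ∷ [])
norm ([] , r₁) (T₂ ∷ P) = just (([] , r₁) ∷ T₂ ∷ P)   -- unreachable: left stack of T is never empty
norm T@(x ∷ l₁ , r₁) (T₂@(l₂ , y ∷ r₂) ∷ P) =
  let z = top l₂ in
  if (x <ᵇ z) ∧ (x <ᵇ y) then just (T ∷ T₂ ∷ P)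
  else if x <ᵇ z then just (weld T T₂ ∷ P)
  else if x <ᵇ y then just (weld (reverseT T) T₂ ∷ P)
  else nothing
norm T@(x ∷ l₁ , r₁) (T₂@(l₂ , []) ∷ []) =
  if x <ᵇ top l₂ then just (T ∷ T₂ ∷ [])
  else if allLt x l₂
       then (if isEmptyT (l₁ , r₁)
             then just ((l₂ ++ [ x ] , []) ∷ [])
             else just (weld (reverseT (l₁ , r₁)) (l₂ ++ [ x ] , []) ∷ []))
  else norm (weld T (reverseT T₂)) []
norm T@(x ∷ l₁ , r₁) (T₂@(l₂ , []) ∷ T₃ ∷ P) =
  if x <ᵇ top l₂ then just (T ∷ T₂ ∷ T₃ ∷ P)
  else norm (weld T (reverseT T₂)) (T₃ ∷ P)

normalize : Pile → Maybe Pile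
normalize []      = just []
normalize (T ∷ P) = norm T P

orient : Twin → Twin
orient (l , r) = if top l <ᵇ top r then (r , l) else (l , r)

singleLargest : List ℕ → List ℕ → Bool
singleLargest (m ∷ []) t = allLt m t
singleLargest _        t = false

monotonic : Twin → Bool
monotonic ([] , r) = true
monotonic (l , []) = true
monotonic (l , r)  = if singleLargest l r then true else singleLargest r l

oneSided : Twin → Twin
oneSided ([] , r) = (r , [])
oneSided (l , []) = (l , [])
oneSided (l , r)  =
  if singleLargest l r then (r ++ l , [])
  else if singleLargest r l then (l ++ r , [])
  else (l , r)

afterPop : Bool → Twin → Pile → Pile
afterPop fromRight T P =
  if isEmptyT T then P
  else (finish P (orient T) ∷ P)
  where
    finish : Pile → Twin → Twin
    finish [] T' = if fromRight ∧ monotonic T' then oneSided T' else T'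
    finish _  T' = T'

-- fuel bounds the number of moves (one element is output per move)
toOutput : ℕ → List ℕ → Pile → List ℕ × Pile
toOutput zero    O P = (O , P)
toOutput (suc k) O [] = (O , [])
toOutput (suc k) O ((l , r) ∷ P) =
  let c = suc (length O) in
  popR c l r
  where
    popL : ℕ → List ℕ → List ℕ → List ℕ × Pile
    popL c (x ∷ l') r = if x ≡ᵇ c then toOutput k (O ++ [ x ]) (afterPop false (l' , r) P)
                        else (O , (x ∷ l' , r) ∷ P)
    popL c [] r = (O , ([] , r) ∷ P)
    popR : ℕ → List ℕ → List ℕ → List ℕ × Pile
    popR c l (y ∷ r') = if y ≡ᵇ c then toOutput k (O ++ [ y ]) (afterPop true (l , r') P)
                        else popL c l (y ∷ r')
    popR c l [] = popL c l []

rtmLoop : ℕ → List ℕ → List ℕ → Pile → Bool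
rtmLoop n []      O P = true
rtmLoop n (x ∷ I) O P with normalize ((x ∷ [] , []) ∷ P)
... | nothing = false
... | just P' with toOutput n O P'
...   | (O' , P'') = rtmLoop n I O' P''

RTM : List ℕ → Bool
RTM π = rtmLoop (length π) π [] []

{-# OPTIONS --safe #-}
-- A pile stands for a set of deques: every twinstack may independently be reversed, and is
-- wrapped around the deque of the twinstacks below it (Conf).  Two facts link the algorithm to
-- actual deques.  Every deque that the pile stands for is reachable, whatever the input; hence
-- TRUE implies sortable.  Conversely, in a successful run no deque has a valley, i.e. an element
-- with larger elements on both sides, and a valley-free insertion into a represented deque is
-- again represented after Normalize; in particular Normalize does not fail.  This needs the
-- invariant that the elements of a twinstack are smaller than all those below it, and that
-- the larger top of a two-sided twinstack is not the largest of the elements of this twinstack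
-- and of those below, so that exceeding both tops creates a valley.
module Submission where

open import Defs
open import Data.Nat using (ℕ; zero; suc; _+_; _<_; _≤_; _<ᵇ_; _≡ᵇ_; z≤n; s≤s)
open import Data.Nat.Properties
open import Data.Bool using (true; false; if_then_else_; _∧_)
open import Data.Empty using (⊥; ⊥-elim)
open import Data.List using (List; []; _∷_; _++_; [_]; length; applyUpTo; filter; reverse)
open import Data.List.Properties
  using (++-assoc; ++-identityʳ; reverse-++; unfold-reverse; reverse-involutive; length-++;
         length-applyUpTo; applyUpTo-∷ʳ; ∷-injectiveˡ; ∷-injectiveʳ;
         filter-all; filter-accept; filter-reject; filter-++)
open import Data.List.Membership.Propositional using (_∈_; _∉_; find; lose)
open import Data.List.Membership.Propositional.Properties
  using (∈-++⁺ˡ; ∈-++⁺ʳ; ∈-++⁻; ∈-applyUpTo⁺; ∈-applyUpTo⁻)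
open import Data.List.Relation.Unary.All as All using (All; []; _∷_)
import Data.List.Relation.Unary.All.Properties as All
open import Data.List.Relation.Unary.Any as Any using (Any; here; there)
import Data.List.Relation.Unary.Any.Properties as Any
open import Data.List.Relation.Unary.AllPairs as AllPairs using (AllPairs; []; _∷_)
import Data.List.Relation.Unary.AllPairs.Properties as AllPairs
open import Data.List.Relation.Unary.Unique.Propositional using (Unique)
open import Data.List.Relation.Binary.Permutation.Propositional
  using (_↭_; ↭-refl; ↭-reflexive; ↭-sym; ↭-trans; ↭⇒↭ₛ)
open import Data.List.Relation.Binary.Permutation.Propositional.Properties
  using (++⁺; ++⁺ˡ; ++⁺ʳ; ++-comm; shift; shifts; ↭-reverse; ∷↭∷ʳ; ↭-length; ∈-resp-↭; Any-resp-↭; All-resp-↭)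
open import Data.List.Relation.Binary.Sublist.Propositional
  using (_⊆_; []; _∷_; _∷ʳ_; from∈; ⊆-refl; ⊆-trans; lookup)
open import Data.List.Relation.Binary.Sublist.Propositional.Properties
  using (filter-⊆; reverse⁺) renaming (++⁺ʳ to ++⁺ʳ-⊆)
import Data.List.Relation.Binary.Permutation.Setoid.Properties as Permutation
open import Data.Maybe using (Maybe; just; nothing)
open import Data.Product using (_×_; _,_; ∃; proj₁; proj₂)
open import Data.Sum using (_⊎_; inj₁; inj₂)
open import Function using (_∘_; id; case_of_)
open import Function.Bundles using (_⇔_; mk⇔; Equivalence)
import Function.Properties.Equivalence as ⇔
open import Relation.Binary.Definitions using (tri<; tri≈; tri>)
open import Relation.Binary.Construct.Closure.ReflexiveTransitive using (Star; ε; _◅_; _◅◅_)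
open import Relation.Binary.PropositionalEquality
  using (_≡_; _≢_; refl; sym; trans; cong; cong₂; subst; module ≡-Reasoning)
open import Relation.Binary.PropositionalEquality.Properties using (setoid)
open import Relation.Nullary using (¬_; Reflects; ofʸ; ofⁿ; contradiction)
open import Relation.Nullary.Decidable using (proof)

variable
  b c n x y z : ℕ
  d d′ e l r s u v E I O : List ℕ
  P P′ : Pile
  T : Twin

-- Deques represented by a pile

elems : Pile → List ℕ
elems []            = []
elems ((l , r) ∷ P) = l ++ r ++ elems P

-- Stacks are listed top first and their tops are the ends of the deque, so the stack lying on the
-- right is read in reverse.
Conf : Pile → List ℕ → Set
Conf []            d = d ≡ []
Conf ((l , r) ∷ P) d = ∃ λ e → Conf P e × (d ≡ l ++ e ++ reverse r ⊎ d ≡ r ++ e ++ reverse l)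

Conf-inhabited : ∀ P → ∃ (Conf P)
Conf-inhabited []            = [] , refl
Conf-inhabited ((l , r) ∷ P) with Conf-inhabited P
... | e , cf = _ , e , cf , inj₁ refl

Conf-reverseT : ∀ T → Conf (reverseT T ∷ P) d → Conf (T ∷ P) d
Conf-reverseT _ (e , cf , inj₁ eq) = e , cf , inj₂ eq
Conf-reverseT _ (e , cf , inj₂ eq) = e , cf , inj₁ eq

Conf-mono : (∀ {d} → Conf P d → Conf P′ d) → Conf (T ∷ P) d → Conf (T ∷ P′) d
Conf-mono f (e , cf , eq) = e , f cf , eq

around-↭ : ∀ l r → e ↭ E → l ++ e ++ reverse r ↭ l ++ r ++ E
around-↭ {e} l r e↭E = ++⁺ˡ l (↭-trans (++-comm e (reverse r)) (++⁺ (↭-reverse r) e↭E))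

Conf-↭ : ∀ P → Conf P d → d ↭ elems P
Conf-↭ []            refl                = ↭-refl
Conf-↭ ((l , r) ∷ P) (e , cf , inj₁ refl) = around-↭ l r (Conf-↭ P cf)
Conf-↭ ((l , r) ∷ P) (e , cf , inj₂ refl) =
  ↭-trans (around-↭ r l (Conf-↭ P cf)) (shifts r l)

reverse-around : ∀ (l e r : List ℕ) → reverse (l ++ e ++ reverse r) ≡ r ++ reverse e ++ reverse l
reverse-around l e r
  rewrite reverse-++ l (e ++ reverse r) | reverse-++ e (reverse r) | reverse-involutive r
        = ++-assoc r (reverse e) (reverse l)

-- Reflecting the deque reverses all twinstacks at once. This later reduces insertions at the right
-- end to insertions at the left end.
Conf-reverse : ∀ P → Conf P d → Conf P (reverse d)
Conf-reverse []            refl                 = refl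
Conf-reverse ((l , r) ∷ P) (e , cf , inj₁ refl) = reverse e , Conf-reverse P cf , inj₂ (reverse-around l e r)
Conf-reverse ((l , r) ∷ P) (e , cf , inj₂ refl) = reverse e , Conf-reverse P cf , inj₁ (reverse-around r e l)

weld-around : ∀ (l₁ l₂ e r₁ r₂ : List ℕ) →
  (l₁ ++ l₂) ++ e ++ reverse (r₁ ++ r₂) ≡ l₁ ++ (l₂ ++ e ++ reverse r₂) ++ reverse r₁
weld-around l₁ l₂ e r₁ r₂
  rewrite reverse-++ r₁ r₂ | ++-assoc l₁ l₂ (e ++ reverse r₂ ++ reverse r₁)
        | ++-assoc l₂ (e ++ reverse r₂) (reverse r₁) | ++-assoc e (reverse r₂) (reverse r₁) = refl

-- Welding fixes the relative orientation of the two twinstacks, so in general deques are lost and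
-- only this inclusion holds. That the lost ones contain valleys is shown in `norm-correct`.
Conf-weld : ∀ T₁ T₂ → Conf (weld T₁ T₂ ∷ P) d → Conf (T₁ ∷ T₂ ∷ P) d
Conf-weld (l₁ , r₁) (l₂ , r₂) (e , cf , inj₁ refl) =
  _ , (e , cf , inj₁ refl) , inj₁ (weld-around l₁ l₂ e r₁ r₂)
Conf-weld (l₁ , r₁) (l₂ , r₂) (e , cf , inj₂ refl) =
  _ , (e , cf , inj₂ refl) , inj₂ (weld-around r₁ r₂ e l₁ l₂)

AtEnd : ℕ → List ℕ → List ℕ → Set
AtEnd x d d′ = d′ ≡ x ∷ d ⊎ d′ ≡ d ++ [ x ]

Conf-push⁻ : Conf (([ x ] , []) ∷ P) d′ → ∃ λ d → Conf P d × AtEnd x d d′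
Conf-push⁻ {x} (e , cf , inj₁ eq) = e , cf , inj₁ (trans eq (cong (x ∷_) (++-identityʳ e)))
Conf-push⁻     (e , cf , inj₂ eq) = e , cf , inj₂ eq

-- The middle element m of a valley has to leave the deque first, but is at neither end.
NoValley : List ℕ → Set
NoValley d = ∀ {p m q} → p ∷ m ∷ q ∷ [] ⊆ d → m < p → m < q → ⊥

valley-front : z < x → Any (z <_) s → ¬ NoValley (x ∷ z ∷ s)
valley-front z<x any nv with find any
... | q , q∈ , z<q = nv (refl ∷ refl ∷ from∈ q∈) z<x z<q

-- Normalize

Sorted : List ℕ → Set
Sorted = AllPairs _<_

Below : List ℕ → List ℕ → Set
Below s E = All (λ e → All (e <_) E) s

data Good (E : List ℕ) : Twin → Set where
  one : Sorted (z ∷ l) → Below (z ∷ l) E → Good E (z ∷ l , [])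
  -- The last premise fails exactly for a monotonic bottom twinstack, which has to be one-sided.
  two : Sorted (z ∷ l) → Sorted (y ∷ r) → Below (z ∷ l) E → Below (y ∷ r) E → y < z →
        Any (z <_) (l ++ y ∷ r ++ E) → Good E (z ∷ l , y ∷ r)

data Inv : Pile → Set where
  []  : Inv []
  _∷_ : Good (elems P) T → Inv P → Inv (T ∷ P)

-- The right stack carried by the top twinstack ([x] , r) during Normalize.
data Carried (x : ℕ) (E : List ℕ) : List ℕ → Set where
  []   : Carried x E []
  cons : Sorted (y ∷ r) → Below (y ∷ r) E → y < x → (E ≡ [] → Any (x <_) r) → Carried x E (y ∷ r)

-- The last premise of `two` asks for an element larger than `x`. Any element of a nonempty pile
-- below serves; over an empty pile the last premise of `cons` supplies one.
good-single : Carried x E r → All (x <_) E → Good E ([ x ] , r)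
good-single [] x<E = one ([] ∷ []) (x<E ∷ [])
good-single {E = []} {r = y ∷ r} (cons sr br y<x h) x<E =
  two ([] ∷ []) sr (x<E ∷ []) br y<x (there (Any.++⁺ˡ (h refl)))
good-single {E = _ ∷ _} {r = y ∷ r} (cons sr br y<x h) x<E@(x<e ∷ _) =
  two ([] ∷ []) sr (x<E ∷ []) br y<x (there (Any.++⁺ʳ r (here x<e)))

sorted-above : Sorted (z ∷ l) → x < z → All (x <_) (z ∷ l)
sorted-above (z<l ∷ _) x<z = x<z ∷ All.map (<-trans x<z) z<l

allLt-reflects : ∀ x l → Reflects (All (_< x) l) (allLt x l)
allLt-reflects x [] = ofʸ []
allLt-reflects x (e ∷ l) with e <ᵇ x | <ᵇ-reflects-< e x | allLt x l | allLt-reflects x l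
... | true  | ofʸ e<x | true  | ofʸ l<x = ofʸ (e<x ∷ l<x)
... | true  | ofʸ e<x | false | ofⁿ l≮x = ofⁿ λ { (_ ∷ p) → l≮x p }
... | false | ofⁿ e≮x | _     | _       = ofⁿ λ { (p ∷ _) → e≮x p }

≮all⇒any> : All (x ≢_) l → ¬ All (_< x) l → Any (x <_) l
≮all⇒any> [] ¬all = contradiction [] ¬all
≮all⇒any> {x} {e ∷ l} (x≢e ∷ x∉l) ¬all with <-cmp x e
... | tri< x<e _ _ = here x<e
... | tri≈ _ x≡e _ = contradiction x≡e x≢e
... | tri> _ _ e<x = there (≮all⇒any> x∉l λ l<x → ¬all (e<x ∷ l<x))

<-<⇒suc≢ : b < x → ∀ {y} → x < y → suc b ≢ y
<-<⇒suc≢ b<x x<y refl = <-irrefl refl (≤-<-trans b<x x<y)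

≢∧≮⇒> : x ≢ z → ¬ x < z → z < x
≢∧≮⇒> {x} {z} x≢z x≮z = ≤∧≢⇒< (≮⇒≥ x≮z) (x≢z ∘ sym)

-- Only the deques with `x` at the left end and the carried `r` at the right end are considered;
-- `push-canonical` reduces the other end to this one by reflection.
data Outcome (x : ℕ) (r : List ℕ) (P : Pile) : Maybe Pile → Set where
  fails    : (∀ {d} → Conf P d → ¬ NoValley (x ∷ d ++ reverse r)) → Outcome x r P nothing
  succeeds : Inv P′ →
             (∀ {d} → Conf P′ d → Conf (([ x ] , r) ∷ P) d) →
             (∀ {d} → Conf P d → NoValley (x ∷ d ++ reverse r) → Conf P′ (x ∷ d ++ reverse r)) →
             Outcome x r P (just P′)

-- With `z` on the left it would stand next to `x` and before a larger element, a valley. Hence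
-- `z ∷ l` must lie on the right, which is what reversing and welding record.
outcome-carry : ∀ {res} → z < x → Any (z <_) (l ++ elems P) →
  Outcome x (r ++ z ∷ l) P res → Outcome x r ((z ∷ l , []) ∷ P) res
outcome-carry {z} {x} {l} {P} {r} {res} z<x any out = go out
  where
  via : ∀ {d} → Conf ((z ∷ l , []) ∷ P) d → NoValley (x ∷ d ++ reverse r) →
        ∃ λ e → Conf P e × (x ∷ d ++ reverse r ≡ x ∷ e ++ reverse (r ++ z ∷ l))
  via (e , cf , inj₁ refl) nv =
    ⊥-elim (valley-front z<x (Any.++⁺ˡ (Any-resp-↭ (↭-sym (around-↭ l [] (Conf-↭ P cf))) any)) nv)
  via (e , cf , inj₂ refl) nv = e , cf , sym (weld-around [ x ] [] e r (z ∷ l))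
  go : Outcome x (r ++ z ∷ l) P res → Outcome x r ((z ∷ l , []) ∷ P) res
  go (fails f) = fails λ cf nv → let e , cf′ , eq = via cf nv in f cf′ (subst NoValley eq nv)
  go (succeeds {P′ = P′} inv sound complete) = succeeds inv
    (λ cf → Conf-mono {P = ([] , z ∷ l) ∷ P} {P′ = (z ∷ l , []) ∷ P} {T = [ x ] , r}
       (Conf-reverseT {P = P} (z ∷ l , [])) (Conf-weld {P = P} ([ x ] , r) ([] , z ∷ l) (sound cf)))
    (λ cf nv → let e , cf′ , eq = via cf nv in
       subst (Conf P′) (sym eq) (complete cf′ (subst NoValley eq nv)))

nonempty : ∀ T P → Inv (T ∷ P) → ∃ λ w → w ∈ elems (T ∷ P)
nonempty _ _ (one _ _ ∷ _)         = _ , here refl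
nonempty _ _ (two _ _ _ _ _ _ ∷ _) = _ , here refl

-- What is already carried is smaller than the whole pile, in particular than `z ∷ l`, so the longer
-- stack is still sorted.
carried-snoc : Carried x (z ∷ l ++ E) r → Sorted (z ∷ l) → Below (z ∷ l) E → z < x →
  (E ≡ [] → Any (x <_) l) → Carried x E (r ++ z ∷ l)
carried-snoc [] sl bl z<x h = cons sl bl z<x h
carried-snoc {l = l} (cons {r = r} sr br y<x _) sl bl z<x h =
  cons (AllPairs.++⁺ sr sl (All.map (All.++⁻ˡ (_ ∷ l)) br))
       (All.++⁺ (All.map (All.++⁻ʳ (_ ∷ l)) br) bl)
       y<x (λ P≡[] → Any.++⁺ʳ r (there (h P≡[])))

-- The new left top `x` has `z` beneath it, which is the larger element that `two` asks for.
good-weld : Carried x (z ∷ l ++ y ∷ s ++ E) r → Good E (z ∷ l , y ∷ s) →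
  y < x → x < z → Good E (x ∷ z ∷ l , r ++ y ∷ s)
good-weld [] (two sl ss bl@(z<P ∷ _) bs _ _) y<x x<z =
  two (sorted-above sl x<z ∷ sl) ss (All.map (<-trans x<z) z<P ∷ bl) bs y<x (here x<z)
good-weld {l = l} {s = s} (cons sr br y′<x _) (two sl ss bl@(z<P ∷ _) bs _ _) y<x x<z =
  two (sorted-above sl x<z ∷ sl)
      (AllPairs.++⁺ sr ss (All.map (All.++⁻ˡ (_ ∷ s) ∘ All.++⁻ʳ (_ ∷ l)) br))
      (All.map (<-trans x<z) z<P ∷ bl)
      (All.++⁺ (All.map (All.++⁻ʳ (_ ∷ s) ∘ All.++⁻ʳ (_ ∷ l)) br) bs)
      y′<x (here x<z)

below-[] : ∀ s → Below s []
below-[] = All.universal (λ _ → [])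

sorted-snoc : Sorted s → All (_< x) s → Sorted (s ++ [ x ])
sorted-snoc ss s<x = AllPairs.++⁺ ss ([] ∷ []) (All.map (_∷ []) s<x)

good-bottom : Carried x (z ∷ l ++ []) r → Sorted (z ∷ l) → All (_< x) (z ∷ l) →
  Good [] (r ++ z ∷ l ++ [ x ] , [])
good-bottom [] sl l<x = one (sorted-snoc sl l<x) (below-[] _)
good-bottom {l = l} (cons sr br y<x _) sl l<x@(z<x ∷ _) = one
  (AllPairs.++⁺ sr (sorted-snoc sl l<x)
    (All.map (λ e<l → let e<l′ = All.++⁻ˡ (_ ∷ l) e<l in
                      All.++⁺ e<l′ (<-trans (All.head e<l′) z<x ∷ [])) br))
  (below-[] _)

-- A second element of the sorted stack would form a valley with `x` and `z`; a single element looks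
-- the same in both orientations.
flat : Sorted (z ∷ l) → z < x → NoValley (x ∷ (z ∷ l ++ []) ++ s) → z ∷ l ++ [] ≡ reverse (z ∷ l)
flat {l = []}     _                _   _  = refl
flat {l = z′ ∷ _} ((z<z′ ∷ _) ∷ _) z<x nv = ⊥-elim (valley-front z<x (here z<z′) nv)

-- Here `x` is the largest element, and a valley-free deque starting with it must decrease. The
-- one-sided twinstack represents just this deque and its reflection.
outcome-bottom : Carried x (z ∷ l ++ []) r → Sorted (z ∷ l) → All (_< x) (z ∷ l) →
  Outcome x r ((z ∷ l , []) ∷ []) (just ((r ++ z ∷ l ++ [ x ] , []) ∷ []))
outcome-bottom {x} {z} {l} {r} carried sl l<x@(z<x ∷ _) = succeeds (good-bottom carried sl l<x ∷ []) sound complete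
  where
  low-end high-end : List ℕ
  low-end  = r ++ ((z ∷ l) ++ [] ++ []) ++ [ x ]
  high-end = x ∷ reverse (z ∷ l) ++ reverse r
  low≡ : (r ++ z ∷ l ++ [ x ]) ++ [] ≡ low-end
  low≡ = trans (++-identityʳ _) (cong (λ t → r ++ t ++ [ x ]) (sym (++-identityʳ (z ∷ l))))
  high≡ : reverse (r ++ z ∷ l ++ [ x ]) ≡ high-end
  high≡ = trans (reverse-++ r (z ∷ l ++ [ x ])) (cong (_++ reverse r) (reverse-++ (z ∷ l) [ x ]))
  sound : ∀ {d} → Conf ((r ++ z ∷ l ++ [ x ] , []) ∷ []) d → Conf (([ x ] , r) ∷ (z ∷ l , []) ∷ []) d
  sound (_ , refl , inj₁ refl) = _ , ([] , refl , inj₁ refl) , inj₂ low≡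
  sound (_ , refl , inj₂ refl) = _ , ([] , refl , inj₂ refl) , inj₁ high≡
  complete : ∀ {d} → Conf ((z ∷ l , []) ∷ []) d → NoValley (x ∷ d ++ reverse r) →
             Conf ((r ++ z ∷ l ++ [ x ] , []) ∷ []) (x ∷ d ++ reverse r)
  complete (_ , refl , inj₂ refl) _ = [] , refl , inj₂ (sym high≡)
  complete (_ , refl , inj₁ refl) nv =
    [] , refl , inj₂ (trans (cong (λ t → x ∷ t ++ reverse r) (flat sl z<x nv)) (sym high≡))

-- Induction on the pile for arbitrary `r`, because each repetition of Normalize adds the left stack
-- of the next twinstack to `r`.
norm-correct : ∀ x r P → Inv P → All (x ≢_) (elems P) → Carried x (elems P) r →
  Outcome x r P (norm ([ x ] , r) P)
norm-correct x r [] inv x∉ carried =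
  succeeds (good-single carried [] ∷ []) id (λ cf _ → _ , cf , inj₁ refl)
norm-correct x r P@((z ∷ l , []) ∷ []) inv@(one sl bl ∷ _) (x≢z ∷ x∉l) carried
  with x <ᵇ z | <ᵇ-reflects-< x z
... | true | ofʸ x<z = succeeds
  (good-single carried (All.++⁺ (sorted-above sl x<z) []) ∷ inv) id (λ cf _ → _ , cf , inj₁ refl)
... | false | ofⁿ x≮z with allLt x (z ∷ l) | allLt-reflects x (z ∷ l)
-- Some element of `l` exceeds `x`. It completes the valley that rules out the left side, and it is
-- the witness that `Carried` demands over an empty pile.
... | false | ofⁿ ¬all = outcome-carry z<x (Any.++⁺ˡ (Any.map (<-trans z<x) x<l))
  (norm-correct x (r ++ z ∷ l) [] [] [] (carried-snoc carried sl bl z<x (λ _ → x<l)))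
  where
  z<x = ≢∧≮⇒> x≢z x≮z
  x<l = ≮all⇒any> (All.++⁻ˡ l x∉l) λ l<x → ¬all (z<x ∷ l<x)
-- The algorithm asks whether the rest of `T` is empty, but both answers give the left stack
-- `r ++ z ∷ l ++ [ x ]`.
... | true | ofʸ l<x with r
...   | []    = outcome-bottom carried sl l<x
...   | _ ∷ _ = outcome-bottom carried sl l<x
norm-correct x r P@((z ∷ l , []) ∷ T₃ ∷ P₃) inv@(one sl bl@(z<P ∷ _) ∷ inv₃) (x≢z ∷ x∉) carried
  with x <ᵇ z | <ᵇ-reflects-< x z
... | true | ofʸ x<z = succeeds
  (good-single carried (All.++⁺ (sorted-above sl x<z) (All.map (<-trans x<z) z<P)) ∷ inv)
  id (λ cf _ → _ , cf , inj₁ refl)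
-- Any element of the remaining nonempty pile exceeds `z` and completes the valley.
... | false | ofⁿ x≮z = outcome-carry z<x (Any.++⁺ʳ l (lose w∈ (All.lookup z<P w∈)))
  (norm-correct x (r ++ z ∷ l) (T₃ ∷ P₃) inv₃ (All.++⁻ʳ l x∉)
    (carried-snoc carried sl bl z<x λ P≡[] → contradiction (subst (proj₁ (nonempty T₃ P₃ inv₃) ∈_) P≡[] w∈) λ ()))
  where
  z<x = ≢∧≮⇒> x≢z x≮z
  w∈ = proj₂ (nonempty T₃ P₃ inv₃)
norm-correct x r P@((z ∷ l , y ∷ s) ∷ P₂) inv@(good@(two sl ss bl@(z<P ∷ _) bs y<z any) ∷ inv₂) (x≢z ∷ x∉) carried
  with x <ᵇ z | <ᵇ-reflects-< x z | x <ᵇ y | <ᵇ-reflects-< x y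
... | true | ofʸ x<z | true | ofʸ x<y = succeeds
  (good-single carried (All.++⁺ (sorted-above sl x<z)
     (All.++⁺ (sorted-above ss x<y) (All.map (<-trans x<z) z<P))) ∷ inv)
  id (λ cf _ → _ , cf , inj₁ refl)
... | true | ofʸ x<z | false | ofⁿ x≮y = succeeds
  (good-weld carried good y<x x<z ∷ inv₂) (Conf-weld ([ x ] , r) (z ∷ l , y ∷ s)) complete
  where
  y<x = ≢∧≮⇒> (All.lookup x∉ (∈-++⁺ʳ l (here refl))) x≮y
  complete : ∀ {d} → Conf P d → NoValley (x ∷ d ++ reverse r) →
             Conf ((x ∷ z ∷ l , r ++ y ∷ s) ∷ P₂) (x ∷ d ++ reverse r)
  complete (e , cf , inj₁ refl) _  = e , cf , inj₁ (sym (weld-around [ x ] (z ∷ l) e r (y ∷ s)))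
  -- The other orientation puts `y` next to `x` with `z` further on, a valley.
  complete (e , cf , inj₂ refl) nv = ⊥-elim (valley-front y<x (Any.++⁺ˡ
    (Any-resp-↭ (↭-sym (around-↭ s (z ∷ l) (Conf-↭ P₂ cf))) (Any.++⁺ʳ s (here y<z)))) nv)
... | false | ofⁿ x≮z | true  | ofʸ x<y = contradiction (<-trans x<y y<z) x≮z
-- Both orientations have a valley: after `x` comes `z` and later the larger element from the last
-- premise of `two`, or `y` and later `z`.
... | false | ofⁿ x≮z | false | _ = fails stuck
  where
  z<x = ≢∧≮⇒> x≢z x≮z
  stuck : ∀ {d} → Conf P d → ¬ NoValley (x ∷ d ++ reverse r)
  stuck (e , cf , inj₁ refl) = valley-front z<x (Any.++⁺ˡ
    (Any-resp-↭ (↭-sym (around-↭ l (y ∷ s) (Conf-↭ P₂ cf))) any))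
  stuck (e , cf , inj₂ refl) = valley-front (<-trans y<z z<x) (Any.++⁺ˡ
    (Any-resp-↭ (↭-sym (around-↭ s (z ∷ l) (Conf-↭ P₂ cf))) (Any.++⁺ʳ s (here y<z))))

-- ToOutput

-- `sound` extends reachability by one output operation; `complete` lets the algorithm output `y`
-- from whichever represented deque is being followed.
record Pop (y : ℕ) (P P′ : Pile) : Set where
  field
    invariant : Inv P′
    sound     : ∀ {d} → Conf P′ d → ∃ λ d′ → Conf P d′ × AtEnd y d d′
    complete  : ∀ {d′} → Conf P d′ → ∃ λ d → Conf P′ d × AtEnd y d d′

snoc-around : ∀ (l e r : List ℕ) y → l ++ e ++ reverse (y ∷ r) ≡ (l ++ e ++ reverse r) ++ [ y ]
snoc-around l e r y
  rewrite unfold-reverse y r | ++-assoc l (e ++ reverse r) [ y ] | ++-assoc e (reverse r) [ y ] = refl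

Conf-pop⁺ : ∀ y l r → Conf ((l , r) ∷ P) d → ∃ λ d′ → Conf ((l , y ∷ r) ∷ P) d′ × AtEnd y d d′
Conf-pop⁺ y l r (e , cf , inj₁ refl) = _ , (e , cf , inj₁ refl) , inj₂ (snoc-around l e r y)
Conf-pop⁺ y l r (e , cf , inj₂ refl) = _ , (e , cf , inj₂ refl) , inj₁ refl

Conf-pop⁻ : ∀ y l r → Conf ((l , y ∷ r) ∷ P) d′ → ∃ λ d → Conf ((l , r) ∷ P) d × AtEnd y d d′
Conf-pop⁻ y l r (e , cf , inj₁ refl) = _ , (e , cf , inj₁ refl) , inj₂ (snoc-around l e r y)
Conf-pop⁻ y l r (e , cf , inj₂ refl) = _ , (e , cf , inj₂ refl) , inj₁ refl

Conf-swap : ∀ T → Conf (reverseT T ∷ P) d ⇔ Conf (T ∷ P) d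
Conf-swap {P} T = mk⇔ (Conf-reverseT {P = P} T) (Conf-reverseT {P = P} (reverseT T))

Conf-orient : ∀ T → Conf (orient T ∷ P) d ⇔ Conf (T ∷ P) d
Conf-orient {P} (l , r) with top l <ᵇ top r
... | true  = Conf-swap {P} (l , r)
... | false = ⇔.refl

-- The bottom twinstack encloses an empty deque, so the bottom of one stack and a lone element of
-- the other occupy the same position.
Conf-bottom : ∀ s z → Conf ((s ++ [ z ] , []) ∷ []) d ⇔ Conf ((s , [ z ]) ∷ []) d
Conf-bottom s z = mk⇔
  (λ { (_ , refl , inj₁ refl) → [] , refl , inj₁ (++-identityʳ _)
     ; (_ , refl , inj₂ refl) → [] , refl , inj₂ (reverse-++ s [ z ]) })
  (λ { (_ , refl , inj₁ refl) → [] , refl , inj₁ (sym (++-identityʳ _))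
     ; (_ , refl , inj₂ refl) → [] , refl , inj₂ (sym (reverse-++ s [ z ])) })

Conf-oneSided : ∀ T → Conf (oneSided T ∷ []) d ⇔ Conf (T ∷ []) d
Conf-oneSided ([]         , r)          = Conf-swap {[]} ([] , r)
Conf-oneSided (_ ∷ _      , [])         = ⇔.refl
Conf-oneSided (z ∷ []     , y ∷ r)      with allLt z (y ∷ r)
Conf-oneSided (z ∷ []     , y ∷ r)      | true  =
  ⇔.trans (Conf-bottom (y ∷ r) z) (Conf-swap {[]} ([ z ] , y ∷ r))
Conf-oneSided (z ∷ []     , y ∷ [])     | false with allLt y [ z ]
... | true  = Conf-bottom [ z ] y
... | false = ⇔.refl
Conf-oneSided (z ∷ []     , y ∷ _ ∷ _)  | false = ⇔.refl
Conf-oneSided (z ∷ z′ ∷ l , y ∷ [])     with allLt y (z ∷ z′ ∷ l)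
... | true  = Conf-bottom (z ∷ z′ ∷ l) y
... | false = ⇔.refl
Conf-oneSided (z ∷ z′ ∷ l , y ∷ _ ∷ _)  = ⇔.refl

Conf-finish : ∀ b T → Conf ((if b then oneSided T else T) ∷ []) d ⇔ Conf (T ∷ []) d
Conf-finish true  T = Conf-oneSided T
Conf-finish false T = ⇔.refl

Conf-drop : Conf P d ⇔ Conf (([] , []) ∷ P) d
Conf-drop {P} = mk⇔
  (λ cf → _ , cf , inj₁ (sym (++-identityʳ _)))
  (λ { (e , cf , inj₁ refl) → subst (Conf P) (sym (++-identityʳ e)) cf
     ; (e , cf , inj₂ refl) → subst (Conf P) (sym (++-identityʳ e)) cf })

-- The clean-up after a pop only changes the description of the deques, so `Pop` reduces to the bare
-- removal. The case split makes `isEmptyT` and the local `finish` compute.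
Conf-afterPop : ∀ b T P → Conf (afterPop b T P) d ⇔ Conf (T ∷ P) d
Conf-afterPop b ([]    , [])       P        = Conf-drop {P}
Conf-afterPop b T@([]    , _ ∷ _)  [] =
  ⇔.trans (Conf-finish (b ∧ monotonic (orient T)) (orient T)) (Conf-orient {[]} T)
Conf-afterPop b T@([]    , _ ∷ _)  P@(_ ∷ _) = Conf-orient {P} T
Conf-afterPop b T@(_ ∷ _ , _)      [] =
  ⇔.trans (Conf-finish (b ∧ monotonic (orient T)) (orient T)) (Conf-orient {[]} T)
Conf-afterPop b T@(_ ∷ _ , _)      P@(_ ∷ _) = Conf-orient {P} T

-- If `l` is nonempty, its first element exceeds `z`, and `y < z` keeps `y` from being the largest.
-- If `l` is empty, either `z` is the largest and `oneSided` acts, or something in `r` exceeds `z`.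
good-finish : Sorted (z ∷ l) → Sorted (y ∷ r) → y < z → All (z ≢_) (y ∷ r) →
  Good [] (if monotonic (z ∷ l , y ∷ r) then oneSided (z ∷ l , y ∷ r) else (z ∷ l , y ∷ r))
good-finish {z} {[]} {y} {r} sl sr y<z z∉ with allLt z (y ∷ r) | allLt-reflects z (y ∷ r)
good-finish sl sr y<z z∉ | true | ofʸ r<z = one (sorted-snoc sr r<z) (below-[] _)
good-finish {r = []}    sl sr y<z z∉ | false | ofⁿ ¬all = contradiction (y<z ∷ []) ¬all
good-finish {r = _ ∷ _} sl sr y<z z∉ | false | ofⁿ ¬all =
  two sl sr (below-[] _) (below-[] _) y<z (Any.++⁺ˡ (≮all⇒any> z∉ ¬all))
good-finish {z} {z′ ∷ l} {y} {[]} sl@((z<z′ ∷ _) ∷ _) sr y<z _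
  with allLt y (z ∷ z′ ∷ l) | allLt-reflects y (z ∷ z′ ∷ l)
... | true  | ofʸ (z<y ∷ _) = contradiction z<y (<-asym y<z)
... | false | _ = two sl sr (below-[] _) (below-[] _) y<z (here z<z′)
good-finish {l = _ ∷ _} {r = _ ∷ _} sl@((z<z′ ∷ _) ∷ _) sr y<z _ =
  two sl sr (below-[] _) (below-[] _) y<z (here z<z′)

good-covered : Inv (T ∷ P) → Sorted (z ∷ l) → Sorted (y ∷ r) →
  Below (z ∷ l) (elems (T ∷ P)) → Below (y ∷ r) (elems (T ∷ P)) → y < z →
  Good (elems (T ∷ P)) (z ∷ l , y ∷ r)
good-covered {T} {P} {l = l} {r = r} inv sl sr bl@(z<E ∷ _) br y<z with nonempty T P inv
... | w , w∈ = two sl sr bl br y<z (Any.++⁺ʳ l (there (Any.++⁺ʳ r (lose w∈ (All.lookup z<E w∈)))))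

disjoint : Unique (u ++ v) → x ∈ u → x ∉ v
disjoint {u = _ ∷ u} (x∉ ∷ _)   (here refl) x∈v = All.lookup x∉ (∈-++⁺ʳ u x∈v) refl
disjoint             (_ ∷ uniq) (there x∈u) x∈v = disjoint uniq x∈u x∈v

unique-++⁻ˡ : ∀ u → Unique (u ++ v) → Unique u
unique-++⁻ˡ []      _           = []
unique-++⁻ˡ (_ ∷ u) (x∉ ∷ uniq) = All.++⁻ˡ u x∉ ∷ unique-++⁻ˡ u uniq

unique-++⁻ʳ : ∀ u → Unique (u ++ v) → Unique v
unique-++⁻ʳ []      uniq       = uniq
unique-++⁻ʳ (_ ∷ u) (_ ∷ uniq) = unique-++⁻ʳ u uniq

afterPop-right : Good (elems P) (z ∷ l , y ∷ r) → Inv P → (∀ {w} → w ∈ z ∷ l → w ∉ r) →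
  Inv (afterPop true (z ∷ l , r) P)
-- An empty stack has `top` 0, so `orient` does not swap, and `oneSided` leaves the result as it is.
afterPop-right {[]} {r = []} (two sl _ bl _ _ _) inv _ = one sl bl ∷ inv
afterPop-right {T ∷ P} {r = []} (two sl _ bl _ _ _) inv _ = one sl bl ∷ inv
afterPop-right {[]} {z} {l} {r = y′ ∷ r} (two sl (_ ∷ sr) _ _ _ _) inv l∌r
  with z <ᵇ y′ | <ᵇ-reflects-< z y′
... | true  | ofʸ z<y′ = good-finish sr sl z<y′ (All.tabulate λ w∈ y′≡w → l∌r w∈ (here (sym y′≡w))) ∷ inv
... | false | ofⁿ z≮y′ = good-finish sl sr (≢∧≮⇒> (All.lookup z∉ (here refl)) z≮y′) z∉ ∷ inv
  where
  z∉ : All (z ≢_) (y′ ∷ r)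
  z∉ = All.tabulate λ { w∈ refl → l∌r (here refl) w∈ }
afterPop-right {T ∷ P} {z} {l} {r = y′ ∷ r} (two sl (_ ∷ sr) bl (_ ∷ br) _ _) inv l∌r
  with z <ᵇ y′ | <ᵇ-reflects-< z y′
... | true  | ofʸ z<y′ = good-covered inv sr sl br bl z<y′ ∷ inv
... | false | ofⁿ z≮y′ =
  good-covered inv sl sr bl br (≢∧≮⇒> (λ { refl → l∌r (here refl) (here refl) }) z≮y′) ∷ inv

-- An empty right stack is the only case for a left pop: a right top would be smaller and therefore
-- due earlier.
afterPop-left : Good (elems P) (z ∷ l , []) → Inv P → Inv (afterPop false (l , []) P)
afterPop-left {l = []}             (one _ _)               inv = inv
afterPop-left {[]}    {l = _ ∷ _} (one (_ ∷ sl) (_ ∷ bl)) inv = one sl bl ∷ inv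
afterPop-left {_ ∷ _} {l = _ ∷ _} (one (_ ∷ sl) (_ ∷ bl)) inv = one sl bl ∷ inv

pop-right : ∀ b → Inv (afterPop b (l , r) P) → Pop y ((l , y ∷ r) ∷ P) (afterPop b (l , r) P)
pop-right {l} {r} {P} {y} b inv = record
  { invariant = inv
  ; sound     = λ cf → Conf-pop⁺ {P} y l r (Equivalence.to (Conf-afterPop b (l , r) P) cf)
  ; complete  = λ cf → let d , cf′ , end = Conf-pop⁻ {P} y l r cf in
                       d , Equivalence.from (Conf-afterPop b (l , r) P) cf′ , end
  }

pop-left : ∀ b → Inv (afterPop b (l , r) P) → Pop y ((y ∷ l , r) ∷ P) (afterPop b (l , r) P)
pop-left {l} {r} {P} {y} b inv = record
  { invariant = inv
  ; sound     = λ cf → let d′ , cf′ , end = Conf-pop⁺ {P} y r l (Conf-reverseT {P = P} (r , l)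
                             (Equivalence.to (Conf-afterPop b (l , r) P) cf)) in
                       d′ , Conf-reverseT {P = P} (y ∷ l , r) cf′ , end
  ; complete  = λ cf → let d , cf′ , end = Conf-pop⁻ {P} y r l (Conf-reverseT {P = P} (r , y ∷ l) cf) in
                       d , Equivalence.from (Conf-afterPop b (l , r) P) (Conf-reverseT {P = P} (l , r) cf′) , end
  }

-- Outputs as initial segments of the target

length-∷ʳ : ∀ O → length (O ++ [ x ]) ≡ suc (length O)
length-∷ʳ O = trans (length-++ O) (+-comm (length O) 1)

↭[1‥]⇒unique : u ↭ [1‥ n ] → Unique u
↭[1‥]⇒unique {n = n} perm = Permutation.Unique-resp-↭ (setoid ℕ) (↭⇒↭ₛ (↭-sym perm))
  (AllPairs.applyUpTo⁺₁ suc n λ i<j _ → <⇒≢ (s≤s i<j))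

length-[1‥] : ∀ n → length [1‥ n ] ≡ n
length-[1‥] = length-applyUpTo suc

-- Arbitrary `f` is needed for the induction, since the tail is enumerated by `f ∘ suc`.
applyUpTo-prefix : ∀ (f : ℕ → ℕ) n u → applyUpTo f n ≡ u ++ v → u ≡ applyUpTo f (length u)
applyUpTo-prefix f n       []      eq = refl
applyUpTo-prefix f (suc n) (x ∷ u) eq =
  cong₂ _∷_ (sym (∷-injectiveˡ eq)) (applyUpTo-prefix (f ∘ suc) n u (∷-injectiveʳ eq))

applyUpTo-at : ∀ (f : ℕ → ℕ) n u → applyUpTo f n ≡ u ++ x ∷ v → x ≡ f (length u)
applyUpTo-at f (suc n) []      eq = sym (∷-injectiveˡ eq)
applyUpTo-at f (suc n) (_ ∷ u) eq = applyUpTo-at (f ∘ suc) n u (∷-injectiveʳ eq)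

-- The output uses up all values up to its length, and a permutation has no repetitions.
pending : O ≡ [1‥ length O ] → O ++ v ↭ [1‥ n ] → All (λ e → length O < e × e ≤ n) v
pending {O} {v} {n} O≡ perm = All.tabulate bounds
  where
  bounds : ∀ {e} → e ∈ v → length O < e × e ≤ n
  bounds e∈v with ∈-applyUpTo⁻ suc (∈-resp-↭ perm (∈-++⁺ʳ O e∈v))
  ... | i , i<n , refl = ≰⇒> (λ i<O → disjoint (↭[1‥]⇒unique perm)
                                (subst (suc i ∈_) (sym O≡) (∈-applyUpTo⁺ suc i<O)) e∈v) , i<n

exhausted : O ≡ [1‥ length O ] → O ++ v ↭ [1‥ n ] → n ≤ length O → v ≡ []
exhausted {v = []}    O≡ perm n≤O = refl
exhausted {v = _ ∷ _} O≡ perm n≤O with pending O≡ perm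
... | (O<e , e≤n) ∷ _ = contradiction (≤-trans e≤n n≤O) (<⇒≱ O<e)

next-pending : O ≡ [1‥ length O ] → O ++ v ↭ [1‥ n ] → length O < n → suc (length O) ∈ v
next-pending {O} O≡ perm O<n with ∈-++⁻ O (∈-resp-↭ (↭-sym perm) (∈-applyUpTo⁺ suc O<n))
... | inj₂ ∈v = ∈v
... | inj₁ ∈O with ∈-applyUpTo⁻ suc (subst (suc (length O) ∈_) O≡ ∈O)
...   | _ , i<O , refl = contradiction i<O (<-irrefl refl)

-- Runs of the deque

AtEnd-↭ : AtEnd x d d′ → d′ ↭ x ∷ d
AtEnd-↭ (inj₁ refl) = ↭-refl
AtEnd-↭ {x} {d} (inj₂ refl) = ↭-sym (∷↭∷ʳ x d)

data InOut : DState → DState → Set where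
  push : AtEnd x d d′ → InOut (O , d , x ∷ I) (O , d′ , I)
  pop  : AtEnd x d d′ → InOut (O , d′ , I) (O ++ [ x ] , d , I)

DStep⇒InOut : ∀ {s t} → DStep s t → InOut s t
DStep⇒InOut inLeft   = push (inj₁ refl)
DStep⇒InOut inRight  = push (inj₂ refl)
DStep⇒InOut outLeft  = pop (inj₁ refl)
DStep⇒InOut outRight = pop (inj₂ refl)

InOut⇒DStep : ∀ {s t} → InOut s t → DStep s t
InOut⇒DStep (push (inj₁ refl)) = inLeft
InOut⇒DStep (push (inj₂ refl)) = inRight
InOut⇒DStep (pop (inj₁ refl))  = outLeft
InOut⇒DStep (pop (inj₂ refl))  = outRight

contents : DState → List ℕ
contents (o , d , i) = o ++ d ++ i

push-↭ : ∀ O I → AtEnd x d d′ → O ++ d ++ x ∷ I ↭ O ++ d′ ++ I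
push-↭ {x} {d} O I end = ++⁺ˡ O (↭-trans (shift x d I) (++⁺ʳ I (↭-sym (AtEnd-↭ end))))

pop-↭ : ∀ O I → AtEnd x d d′ → O ++ d′ ++ I ↭ (O ++ [ x ]) ++ d ++ I
pop-↭ {x} {d} O I end =
  ↭-trans (++⁺ˡ O (++⁺ʳ I (AtEnd-↭ end))) (↭-reflexive (sym (++-assoc O [ x ] (d ++ I))))

InOut-↭ : ∀ {s t} → InOut s t → contents s ↭ contents t
InOut-↭ (push {O = O} {I = I} end) = push-↭ O I end
InOut-↭ (pop {O = O} {I = I} end)  = pop-↭ O I end

run-↭ : ∀ {s t} → Star DStep s t → contents s ↭ contents t
run-↭ ε            = ↭-refl
run-↭ (step ◅ run) = ↭-trans (InOut-↭ (DStep⇒InOut step)) (run-↭ run)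

run-extends : ∀ {s t} → Star DStep s t → ∃ λ u → proj₁ t ≡ proj₁ s ++ u
run-extends ε = [] , sym (++-identityʳ _)
run-extends (step ◅ run) with DStep⇒InOut step | run-extends run
... | push _                | u , eq = u , eq
... | pop {x = x} {O = O} _ | u , eq = x ∷ u , trans eq (++-assoc O [ x ] u)

-- Outputs are only appended to, so in a successful run each one is a prefix of the final one.
run-prefix : Star DStep (O , d , I) ([1‥ n ] , e , v) → O ≡ [1‥ length O ]
run-prefix {O} {n = n} run = applyUpTo-prefix suc n O (proj₂ (run-extends run))

pop-next : Star DStep (O ++ [ x ] , d , I) ([1‥ n ] , e , v) → x ≡ suc (length O)
pop-next {O} {x} {n = n} run with run-extends run
... | u , eq = applyUpTo-at suc n O (trans eq (++-assoc O [ x ] u))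

NoValley-reverse : NoValley d → NoValley (reverse d)
NoValley-reverse {d} nv {p} {m} {q} sub m<p m<q =
  nv (subst (q ∷ m ∷ p ∷ [] ⊆_) (reverse-involutive d) (reverse⁺ sub)) m<q m<p

NoValley-⊆ : d ⊆ d′ → NoValley d′ → NoValley d
NoValley-⊆ sub nv s = nv (⊆-trans s sub)

-- At the front `x` could only be the first flank of a valley, but a flank is not the smallest
-- element.
NoValley-pop : NoValley d → All (x <_) d → NoValley (x ∷ d)
NoValley-pop nv x<d (_ ∷ʳ sub)   m<p m<q = nv sub m<p m<q
NoValley-pop nv x<d (refl ∷ sub) m<p m<q = <-asym m<p (All.lookup x<d (lookup sub (here refl)))

NoValley-unpop : AtEnd x d d′ → NoValley d → All (x <_) d → NoValley d′
NoValley-unpop (inj₁ refl) nv x<d = NoValley-pop nv x<d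
NoValley-unpop {x} {d} (inj₂ refl) nv x<d = subst NoValley
  (trans (unfold-reverse x (reverse d)) (cong (_++ [ x ]) (reverse-involutive d)))
  (NoValley-reverse (NoValley-pop (NoValley-reverse nv) (All-resp-↭ (↭-sym (↭-reverse d)) x<d)))

AtEnd-⊆ : AtEnd x d d′ → d ⊆ d′
AtEnd-⊆ {x} (inj₁ refl) = x ∷ʳ ⊆-refl
AtEnd-⊆ {x} (inj₂ refl) = ++⁺ʳ-⊆ [ x ] ⊆-refl

-- Backwards from the empty final deque: undoing an input step deletes an element, and undoing an
-- output step adds at an end an element smaller than the rest.
run-noValley : Star DStep (O , d , I) ([1‥ n ] , e , v) → O ++ d ++ I ↭ [1‥ n ] → NoValley d
run-noValley {d = d} {n = n} ε perm
  with d | exhausted (cong [1‥_] (sym (length-[1‥] n))) perm (≤-reflexive (sym (length-[1‥] n)))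
... | [] | _ = λ ()
run-noValley (step ◅ run) perm with DStep⇒InOut step
... | push {O = O} {I = I} end =
  NoValley-⊆ (AtEnd-⊆ end) (run-noValley run (↭-trans (↭-sym (push-↭ O I end)) perm))
... | pop {x = x} {d = d} {O = O} {I = I} end =
  NoValley-unpop end (run-noValley run perm′) (All.++⁻ˡ d (All.map below (pending (run-prefix run) perm′)))
  where
  perm′ = ↭-trans (↭-sym (pop-↭ O I end)) perm
  below : ∀ {e} → length (O ++ [ x ]) < e × e ≤ _ → x < e
  below {e} (h , _) = subst (_< e) (trans (length-∷ʳ O) (sym (pop-next run))) h

-- The algorithm against an arbitrary run

filter-atEnd : AtEnd x d d′ → b < x → AtEnd x (filter (b <?_) d) (filter (b <?_) d′)
filter-atEnd {b = b} (inj₁ refl) b<x = inj₁ (filter-accept (b <?_) b<x)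
filter-atEnd {x} {d} {b = b} (inj₂ refl) b<x = inj₂
  (trans (filter-++ (b <?_) d [ x ]) (cong (filter (b <?_) d ++_) (filter-accept (b <?_) b<x)))

filter-popped : AtEnd x d d′ → ¬ b < x → filter (b <?_) d′ ≡ filter (b <?_) d
filter-popped {b = b} (inj₁ refl) b≮x = filter-reject (b <?_) b≮x
filter-popped {x} {d} {b = b} (inj₂ refl) b≮x =
  trans (filter-++ (b <?_) d [ x ])
    (trans (cong (filter (b <?_) d ++_) (filter-reject (b <?_) b≮x)) (++-identityʳ _))

filter-filter : ∀ d → b ≤ c → filter (c <?_) (filter (b <?_) d) ≡ filter (c <?_) d
filter-filter [] b≤c = refl
filter-filter {b} {c} (x ∷ d) b≤c with <-≤-connex b x | <-≤-connex c x
... | inj₂ x≤b | _ = begin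
  filter (c <?_) (filter (b <?_) (x ∷ d)) ≡⟨ cong (filter (c <?_)) (filter-reject (b <?_) (≤⇒≯ x≤b)) ⟩
  filter (c <?_) (filter (b <?_) d)       ≡⟨ filter-filter d b≤c ⟩
  filter (c <?_) d                        ≡⟨ filter-reject (c <?_) (≤⇒≯ (≤-trans x≤b b≤c)) ⟨
  filter (c <?_) (x ∷ d)                  ∎
  where open ≡-Reasoning
... | inj₁ b<x | inj₁ c<x = begin
  filter (c <?_) (filter (b <?_) (x ∷ d)) ≡⟨ cong (filter (c <?_)) (filter-accept (b <?_) b<x) ⟩
  filter (c <?_) (x ∷ filter (b <?_) d)   ≡⟨ filter-accept (c <?_) c<x ⟩
  x ∷ filter (c <?_) (filter (b <?_) d)   ≡⟨ cong (x ∷_) (filter-filter d b≤c) ⟩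
  x ∷ filter (c <?_) d                    ≡⟨ filter-accept (c <?_) c<x ⟨
  filter (c <?_) (x ∷ d)                  ∎
  where open ≡-Reasoning
... | inj₁ b<x | inj₂ x≤c = begin
  filter (c <?_) (filter (b <?_) (x ∷ d)) ≡⟨ cong (filter (c <?_)) (filter-accept (b <?_) b<x) ⟩
  filter (c <?_) (x ∷ filter (b <?_) d)   ≡⟨ filter-reject (c <?_) (≤⇒≯ x≤c) ⟩
  filter (c <?_) (filter (b <?_) d)       ≡⟨ filter-filter d b≤c ⟩
  filter (c <?_) d                        ≡⟨ filter-reject (c <?_) (≤⇒≯ x≤c) ⟨
  filter (c <?_) (x ∷ d)                  ∎
  where open ≡-Reasoning

-- A right insertion is reflected into a left one; the last component carries the result back for
-- whatever pile Normalize produces. The suffix `++ []` is `reverse r` for the initial empty `r`.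
push-canonical : ∀ P → Conf P d → AtEnd x d d′ → NoValley d′ →
  ∃ λ e → Conf P e × NoValley (x ∷ e ++ []) × (∀ P′ → Conf P′ (x ∷ e ++ []) → Conf P′ d′)
push-canonical {d} {x} P cf (inj₁ refl) nv =
  d , cf , subst NoValley (sym eq) nv , λ P′ → subst (Conf P′) eq
  where eq = cong (x ∷_) (++-identityʳ d)
push-canonical {d} {x} P cf (inj₂ refl) nv =
  reverse d , Conf-reverse P cf , subst NoValley eq (NoValley-reverse nv) ,
  λ P′ cf′ → subst (Conf P′) (trans (cong reverse (sym eq)) (reverse-involutive (d ++ [ x ])))
                              (Conf-reverse P′ cf′)
  where eq = trans (reverse-++ d [ x ]) (cong (x ∷_) (sym (++-identityʳ (reverse d))))

module _ {n π} (π↭ : π ↭ [1‥ n ]) where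

  -- All represented deques must be reachable, since later welds decide which of them survive.
  record Tracks (O : List ℕ) (P : Pile) (I : List ℕ) : Set where
    field
      invariant : Inv P
      prefix    : O ≡ [1‥ length O ]
      reach     : ∀ {d} → Conf P d → Star DStep ([] , [] , π) (O , d , I)

    balance : O ++ elems P ++ I ↭ [1‥ n ]
    balance with Conf-inhabited P
    ... | d , cf = ↭-trans (++⁺ˡ O (++⁺ʳ I (↭-sym (Conf-↭ P cf)))) (↭-trans (↭-sym (run-↭ (reach cf))) π↭)

    bounds : All (λ e → length O < e × e ≤ n) (elems P ++ I)
    bounds = pending prefix balance

    elems-above : All (length O <_) (elems P)
    elems-above = All.map proj₁ (All.++⁻ˡ (elems P) bounds)

    conf-above : Conf P d → All (length O <_) d
    conf-above cf = All-resp-↭ (↭-sym (Conf-↭ P cf)) elems-above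

    unique : Unique (elems P ++ I)
    unique = unique-++⁻ʳ O (↭[1‥]⇒unique balance)

  -- Records that ToOutput is greedy: a successful run can never output an element before the
  -- algorithm has done so.
  Settled : List ℕ → Pile → Set
  Settled O P = suc (length O) ∉ elems P

  data Emitted (O : List ℕ) (P : Pile) (I : List ℕ) : List ℕ × Pile → Set where
    emitted : ∀ {O′ P′} → Tracks O′ P′ I → Settled O′ P′ → length O ≤ length O′ →
              (∀ {d} → Conf P d → Conf P′ (filter (length O′ <?_) d)) → Emitted O P I (O′ , P′)

  tracks-pop : Pop y P P′ → y ≡ suc (length O) → Tracks O P I → Tracks (O ++ [ y ]) P′ I
  tracks-pop {y} {O = O} p refl tr = record
    { invariant = Pop.invariant p
    ; prefix    = trans (cong (_++ [ y ]) (Tracks.prefix tr))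
                    (trans (applyUpTo-∷ʳ suc (length O)) (cong [1‥_] (sym (length-∷ʳ O))))
    ; reach     = λ cf → let d′ , cf′ , end = Pop.sound p cf in
                         Tracks.reach tr cf′ ◅◅ (InOut⇒DStep (pop end) ◅ ε)
    }

  emitted-pop : ∀ {res} → Pop y P P′ → y ≡ suc (length O) →
    Emitted (O ++ [ y ]) P′ I res → Emitted O P I res
  emitted-pop {O = O} p refl (emitted {P′ = P″} tr settled O≤O′ complete) =
    emitted tr settled (<⇒≤ O<O′) λ cf → let d , cf′ , end = Pop.complete p cf in
      subst (Conf P″) (sym (filter-popped end (≤⇒≯ O<O′))) (complete cf′)
    where O<O′ = subst (_≤ _) (length-∷ʳ O) O≤O′

  emitted-stop : Tracks O P I → All (suc (length O) ≢_) (elems P) → Emitted O P I (O , P)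
  emitted-stop {O} {P} tr next∉ = emitted tr (λ next∈ → All.lookup next∉ next∈ refl) ≤-refl λ cf →
    subst (Conf P) (sym (filter-all (length O <?_) (Tracks.conf-above tr cf))) cf

  fuel : ∀ k O → n ≤ suc k + length O → n ≤ k + length (O ++ [ y ])
  fuel k O = subst (n ≤_) (trans (sym (+-suc k (length O))) (cong (k +_) (sym (length-∷ʳ O))))

  -- When the fuel is used up, `n ≤ length O` and nothing is pending, so the cut-off is harmless.
  -- Otherwise only the tops of the first twinstack can be due, as every other element of the pile
  -- exceeds one of them.
  toOutput-correct : ∀ k O P → Tracks O P I → n ≤ k + length O → Emitted O P I (toOutput k O P)
  toOutput-correct zero O P tr n≤O = emitted-stop tr (All.tabulate λ { e∈P refl →
    <⇒≱ (proj₂ (All.lookup (Tracks.bounds tr) (∈-++⁺ˡ e∈P))) n≤O })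
  toOutput-correct (suc k) O [] tr _ = emitted-stop tr []
  toOutput-correct (suc k) O (([] , _) ∷ P) tr _ with Tracks.invariant tr
  ... | () ∷ _
  toOutput-correct (suc k) O ((z ∷ l , []) ∷ P) tr n≤
    with z ≡ᵇ suc (length O) | proof (z ≟ suc (length O)) | Tracks.invariant tr
  ... | true | ofʸ z≡ | good ∷ inv =
    emitted-pop p z≡ (toOutput-correct k _ _ (tracks-pop p z≡ tr) (fuel k O n≤))
    where p = pop-left {l = l} {r = []} {P = P} false (afterPop-left good inv)
  ... | false | ofⁿ z≢ | one (z<l ∷ _) (z<P ∷ _) ∷ _ = emitted-stop tr 
    (z≢ ∘ sym ∷ All.++⁺ (All.map (<-<⇒suc≢ O<z) z<l) (All.map (<-<⇒suc≢ O<z) z<P))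
    where O<z = All.head (Tracks.elems-above tr)
  toOutput-correct (suc k) O ((z ∷ l , y ∷ r) ∷ P) tr n≤
    with y ≡ᵇ suc (length O) | proof (y ≟ suc (length O)) | Tracks.invariant tr
  ... | true | ofʸ y≡ | good ∷ inv =
    emitted-pop p y≡ (toOutput-correct k _ _ (tracks-pop p y≡ tr) (fuel k O n≤))
    where
    p = pop-right {l = z ∷ l} {r = r} {P = P} true (afterPop-right good inv λ w∈l w∈r →
          disjoint {u = z ∷ l} (unique-++⁻ˡ (elems ((z ∷ l , y ∷ r) ∷ P)) (Tracks.unique tr))
                   w∈l (there (∈-++⁺ˡ w∈r)))
  ... | false | ofⁿ y≢ | two (z<l ∷ _) (y<r ∷ _) (z<P ∷ _) _ y<z _ ∷ _
    with z ≡ᵇ suc (length O) | proof (z ≟ suc (length O))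
  -- The smaller `y` is still pending, so `z` cannot be the next output.
  ... | true | ofʸ z≡ = contradiction (sym z≡) (<-<⇒suc≢ O<y y<z)
    where O<y = All.lookup (Tracks.elems-above tr) (there (∈-++⁺ʳ l (here refl)))
  ... | false | ofⁿ z≢ = emitted-stop tr 
    (z≢ ∘ sym ∷ All.++⁺ (All.map (<-<⇒suc≢ O<z) z<l)
      (y≢ ∘ sym ∷ All.++⁺ (All.map (<-<⇒suc≢ O<y) y<r) (All.map (<-<⇒suc≢ O<z) z<P)))
    where
    O<z = All.head (Tracks.elems-above tr)
    O<y = All.lookup (Tracks.elems-above tr) (there (∈-++⁺ʳ l (here refl)))

  tracks-push : Tracks O P (x ∷ I) → Inv P′ → (∀ {d} → Conf P′ d → Conf (([ x ] , []) ∷ P) d) → Tracks O P′ I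
  tracks-push {P = P} tr inv sound = record
    { invariant = inv
    ; prefix    = Tracks.prefix tr
    ; reach     = λ cf → let d , cf′ , end = Conf-push⁻ {P = P} (sound cf) in
                         Tracks.reach tr cf′ ◅◅ (InOut⇒DStep (push end) ◅ ε)
    }

  push-outcome : Tracks O P (x ∷ I) → Outcome x [] P (norm ([ x ] , []) P)
  push-outcome {P = P} {x = x} tr = norm-correct x [] P (Tracks.invariant tr)
    (All.tabulate λ { w∈ refl → disjoint (Tracks.unique tr) w∈ (here refl) }) []

  rtmLoop-sound : ∀ I O P → Tracks O P I → Settled O P → rtmLoop n I O P ≡ true →
    ∃ λ d → Star DStep ([] , [] , π) ([1‥ n ] , d , [])
  rtmLoop-sound [] O P tr settled _ = _ ,
    subst (λ o → Star DStep ([] , [] , π) (o , _ , [])) O≡ (Tracks.reach tr (proj₂ (Conf-inhabited P)))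
    where
    -- With no input left, a missing next element would be in the pile, against `Settled`.
    n≤O : n ≤ length O
    n≤O = ≮⇒≥ λ O<n → settled (subst (suc (length O) ∈_) (++-identityʳ (elems P))
                        (next-pending (Tracks.prefix tr) (Tracks.balance tr) O<n))
    O↭ : O ↭ [1‥ n ]
    O↭ = ↭-trans (↭-reflexive (sym (trans
           (cong (O ++_) (exhausted (Tracks.prefix tr) (Tracks.balance tr) n≤O)) (++-identityʳ O))))
           (Tracks.balance tr)
    O≡ : O ≡ [1‥ n ]
    O≡ = trans (Tracks.prefix tr) (cong [1‥_] (trans (↭-length O↭) (length-[1‥] n)))
  rtmLoop-sound (x ∷ I) O P tr settled eq with norm ([ x ] , []) P | push-outcome tr
  ... | just P′ | succeeds inv sound _
    with toOutput n O P′ | toOutput-correct n O P′ (tracks-push tr inv sound) (m≤m+n n (length O))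
  ... | O″ , P″ | emitted tr″ settled″ _ _ = rtmLoop-sound I O″ P″ tr″ settled″ eq

  -- The run need not output as early as the algorithm does,
  -- so its deque is compared after deleting what the algorithm has already output.
  rtmLoop-complete : ∀ {i} → Star DStep (u , v , I) ([1‥ n ] , e , i) → u ++ v ++ I ↭ [1‥ n ] →
    length u ≤ length O → Tracks O P I → Settled O P → Conf P (filter (length O <?_) v) →
    rtmLoop n I O P ≡ true
  rtmLoop-complete {I = []} ε _ _ _ _ _ = refl
  rtmLoop-complete {I = x ∷ I} {P = P} ε _ u≤O tr _ _ = contradiction
    (exhausted (Tracks.prefix tr) (Tracks.balance tr) (≤-trans (≤-reflexive (sym (length-[1‥] n))) u≤O))
    λ eq → case subst (x ∈_) eq (∈-++⁺ʳ (elems P) (here refl)) of λ ()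
  rtmLoop-complete {O = O} {P = P} (step ◅ run) perm u≤O tr settled cf with DStep⇒InOut step
  ... | pop {x = x} {O = u} {I = I} end = rtmLoop-complete run (↭-trans (↭-sym (pop-↭ u I end)) perm)
      (subst (_≤ length O) (trans x≡ (sym (length-∷ʳ u))) (≮⇒≥ O≮x)) tr settled
      (subst (Conf P) (filter-popped end O≮x) cf)
    where
    x≡ = pop-next run
    -- The run's output is no longer than the algorithm's, so an `x` not yet output by the algorithm
    -- would be exactly its next element and lie in the pile, against `Settled`.
    O≮x : ¬ length O < x
    O≮x O<x = settled (∈-resp-↭ (Conf-↭ P cf) (∈-resp-↭ (↭-sym (AtEnd-↭ (filter-atEnd end O<x)))
      (here (≤-antisym O<x (subst (_≤ suc (length O)) (sym x≡) (s≤s u≤O))))))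
  ... | push {x = x} {d′ = v′} {O = u} {I = I} end
    -- The inserted `x` is pending for the algorithm too, so it survives the filter; filtering
    -- cannot create a valley.
    with push-canonical P cf
           (filter-atEnd end (proj₁ (All.lookup (Tracks.bounds tr) (∈-++⁺ʳ (elems P) (here refl)))))
           (NoValley-⊆ (filter-⊆ (length O <?_) v′) (run-noValley run (↭-trans (↭-sym (push-↭ u I end)) perm)))
  ... | _ , cf′ , nv , transfer with norm ([ x ] , []) P | push-outcome tr
  ... | nothing | fails stuck = ⊥-elim (stuck cf′ nv)
  ... | just P′ | succeeds inv sound complete
    with toOutput n O P′ | toOutput-correct n O P′ (tracks-push tr inv sound) (m≤m+n n (length O))
  ... | O″ , P″ | emitted tr″ settled″ O≤O″ complete″ =
    rtmLoop-complete run (↭-trans (↭-sym (push-↭ u I end)) perm) (≤-trans u≤O O≤O″) tr″ settled″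
      (subst (Conf P″) (filter-filter v′ O≤O″) (complete″ (transfer P′ (complete cf′ nv))))

theorem5p4 : (n : ℕ) (π : List ℕ) → π ↭ [1‥ n ] →
    (RTM π ≡ true) ⇔ DequeSortable π
-- Identifies `n` with `length π`, which is both the fuel in `RTM` and the target bound in
-- `DequeSortable`.
theorem5p4 n π π↭ with trans (↭-length π↭) (length-[1‥] n)
... | refl = mk⇔
  (λ eq → let d , run = rtmLoop-sound π↭ π [] [] start (λ ()) eq in d , [] , run)
  (λ { (_ , _ , run) → rtmLoop-complete π↭ run π↭ z≤n start (λ ()) refl })
  where
  start : Tracks π↭ [] [] π
  start = record { invariant = [] ; prefix = refl ; reach = λ { refl → ε } }
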